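{- Let $T$ be a tournament on $n$ vertices. If $\pi_2(T) > (7n-10)/36$, then $T$ is path extendable.
   Context: For distinct vertices $u,v$ of a tournament $T$, $p_2(u,v)$ denotes the number of directed paths of length $2$ (with $2$ arcs) from $u$ to $v$ in $T$, and $\pi_2(T)=\min\{p_2(u,v) : u,v\in V(T),\ u\neq v\}$. All paths are directed paths. A path $P$ that is not hamiltonian is called extendable if there is a path $P'$ with the same initial and the same terminal vertex as $P$ and $V(P')=V(P)\cup\{w\}$ for some vertex $w\in V(T)\setminus V(P)$. A digraph is path extendable if every nonhamiltonian path of length at least $1$ in it is extendable. -}

module Defs where

open import Data.Nat using (ℕ; _<_)
open import Data.Bool using (Bool; true; false; not; _∧_)
open import Data.Fin using (Fin)
open import Data.List using (List; []; _∷_; _++_; [_]; length; filter; allFin)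
open import Data.List.Relation.Unary.Linked using (Linked)
open import Data.List.Relation.Unary.Unique.Propositional using (Unique)
open import Data.List.Membership.Propositional using (_∉_)
open import Data.List.Relation.Binary.Permutation.Propositional using (_↭_)
open import Data.Product using (Σ; ∃; _×_)
open import Relation.Binary.PropositionalEquality using (_≡_; _≢_)
open import Relation.Nullary.Decidable using (Dec; _because_)
open import Data.Bool using (T?)

record Tournament (n : ℕ) : Set where
  field
    adj     : Fin n → Fin n → Bool
    irrefl  : ∀ u → adj u u ≡ false
    tourn   : ∀ u v → u ≢ v → adj u v ≡ not (adj v u)

open Tournament public

Arc : ∀ {n} → Tournament n → Fin n → Fin n → Set
Arc T u v = adj T u v ≡ true

p₂ : ∀ {n} → Tournament n → Fin n → Fin n → ℕ
p₂ {n} T u v = length (filter (λ w → T? (adj T u w ∧ adj T w v)) (allFin n))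

IsPath : ∀ {n} → Tournament n → Fin n → Fin n → List (Fin n) → Set
IsPath T u v xs = Σ (List _) (λ ms → xs ≡ u ∷ (ms ++ [ v ])) × Linked (Arc T) xs × Unique xs

Extendable : ∀ {n} → Tournament n → Fin n → Fin n → List (Fin n) → Set
Extendable T u v xs =
  ∃ λ ys → IsPath T u v ys × ∃ λ w → (w ∉ xs) × (ys ↭ (w ∷ xs))

PathExtendable : ∀ {n} → Tournament n → Set
PathExtendable {n} T =
  ∀ u v xs → IsPath T u v xs → length xs < n → Extendable T u v xs

{-# OPTIONS --safe #-}

-- Let P be a path from u to v that cannot be extended and let W be the set of vertices
-- outside P. No w in W can be inserted between consecutive vertices of P, so w dominates
-- an initial segment of P and is dominated by the rest. Hence P and W can be merged into
-- one linear order in which every arc between P and W points backward. If x precedes y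
-- in the same class (P or W), then all 2-paths from x to y stay in that class; for the
-- initial block I of the order, contained in one class C, this holds for all pairs in
-- I, in both directions. Let π be a lower bound for p₂.
--   * Each class has at least 2π + 2 elements: look at the out-neighbourhood of its first
--     element. (This needs two elements; if W = {w}, then P is extended by a rotation.)
--   * |I| ≥ π: all 2-paths from the first vertex after I to the last vertex of C have
--     their middle in I.
--   * Counting the 2-paths between pairs in I by their middle then gives |C| ≥ 4π − 2.
-- So n ≥ 6π (apart from π = 1, where n ≥ 8), contradicting 7n < 36π + 10.
module Submission where

open import Defs
open import Data.Nat using (ℕ; zero; suc; _+_; _*_; _≤_; _<_; z≤n; s≤s; >-nonZero; s≤s⁻¹)
open import Data.Nat.Properties
open import Data.Nat.Tactic.RingSolver using (solve-∀)
open import Data.Bool using (Bool; true; false; not; _∧_; T?)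
open import Data.Fin using (Fin; zero; suc)
import Data.Fin.Properties as Fin
open import Data.List
  using (length; filter; tabulate; List; []; _∷_; _++_; [_]; last; lookup; initLast; _∷ʳ′_)
open import Data.Product using (∃; _×_; _,_; ∃₂; proj₁; proj₂)
open import Data.Sum using (inj₁; inj₂; _⊎_)
open import Function using (_∘_)
open import Relation.Binary.PropositionalEquality
  using (_≡_; _≢_; refl; sym; trans; cong; cong₂; subst; subst₂; setoid; module ≡-Reasoning)
open import Relation.Nullary using (yes; no; contradiction; ¬_; does; ¬?; _×-dec_)
open import Algebra.Properties.Semiring.Sum +-*-semiring
  using (sum; ∑-distrib-+; ∑-comm; *-distribˡ-sum; *-distribʳ-sum; sum-cong-≗)
open import Algebra.Properties.CommutativeSemigroup +-commutativeSemigroup using (xy∙z≈xz∙y)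
import Data.Bool.Properties as Bool
open import Data.List.Properties using (++-assoc; ∷-injectiveˡ; ∷-injectiveʳ)
open import Data.List.Membership.Propositional using (_∈_; _∉_)
open import Data.List.Membership.Propositional.Properties
  using (∈-++⁻; ∈-++⁺ˡ; ∈-++⁺ʳ; ∈-∃++; ∈-insert)
open import Data.List.Membership.DecPropositional using (_∈?_)
open import Data.List.Relation.Unary.All as All using (All; []; _∷_)
import Data.List.Relation.Unary.All.Properties as All
open import Data.List.Relation.Unary.AllPairs using (AllPairs; []; _∷_)
open import Data.List.Relation.Unary.Any using (here; there; index; tail)
open import Data.List.Relation.Unary.Any.Properties using (lookup-index)
open import Data.List.Relation.Unary.Linked using (Linked; []; [-]; _∷_)
import Data.List.Relation.Unary.Linked.Properties as Linked
open import Data.List.Relation.Unary.Unique.Propositional using (Unique)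
open import Data.List.Relation.Binary.Permutation.Propositional
  using (_↭_; ↭-sym; ↭-trans; ↭-prep; ↭-reflexive; ↭⇒↭ₛ)
open import Data.List.Relation.Binary.Permutation.Propositional.Properties
  using (shift; shifts; ++⁺ˡ)
import Data.List.Relation.Binary.Permutation.Setoid.Properties as Permutationₛ
open import Data.Maybe using (just)
open import Data.Maybe.Relation.Binary.Connected using (Connected; just; nothing-just)
import Data.Sum.Effectful.Left as Sumₗ
open import Level using (0ℓ)
open import Data.Empty using (⊥-elim)
open import Relation.Binary using (Rel)
open import Relation.Unary using (Pred; Decidable)
open import Relation.Nullary.Decidable using (dec-true; dec-false; decidable-stable)
open import Data.Nat.DivMod using (_/_; _%_; m≡m%n+[m/n]*n; m%n<n; m/n*n≤m)

-- Sums of indicators over a finite vertex set.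

𝟙 : Bool → ℕ
𝟙 true  = 1
𝟙 false = 0

count : ∀ {n} → (Fin n → Bool) → ℕ
count S = sum (𝟙 ∘ S)

𝟙-∧ : ∀ a b → 𝟙 (a ∧ b) ≡ 𝟙 a * 𝟙 b
𝟙-∧ true  b = sym (+-identityʳ (𝟙 b))
𝟙-∧ false b = refl

𝟙-mono : ∀ {a b} → (a ≡ true → b ≡ true) → 𝟙 a ≤ 𝟙 b
𝟙-mono {false}     h = z≤n
𝟙-mono {true}  {b} h rewrite h refl = ≤-refl

𝟙-weigh : ∀ b {m k} → (b ≡ true → m ≤ k) → 𝟙 b * m ≤ 𝟙 b * k
𝟙-weigh false h = z≤n
𝟙-weigh true  h = *-monoʳ-≤ 1 (h refl)

∧-true⁻ : ∀ {a b} → a ∧ b ≡ true → a ≡ true × b ≡ true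
∧-true⁻ {true} {true} _ = refl , refl

∧-true⁺ : ∀ {a b} → a ≡ true → b ≡ true → a ∧ b ≡ true
∧-true⁺ refl refl = refl

length-filter-tabulate : ∀ {n} {A : Set} (f : A → Bool) (g : Fin n → A) →
  length (filter (T? ∘ f) (tabulate g)) ≡ count (f ∘ g)
length-filter-tabulate {zero}  f g = refl
length-filter-tabulate {suc n} f g with f (g zero)
... | true  = cong suc (length-filter-tabulate f (g ∘ suc))
... | false = length-filter-tabulate f (g ∘ suc)

sum-mono : ∀ {n} {f g : Fin n → ℕ} → (∀ y → f y ≤ g y) → sum f ≤ sum g
sum-mono {zero}  h = z≤n
sum-mono {suc n} h = +-mono-≤ (h zero) (sum-mono (h ∘ suc))

-- The surpluses `a` and `b` at the single index `x` express strictness there, or pay for a diagonal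
-- term that the comparison elsewhere does not cover.
sum-mono-at : ∀ {n} {f g : Fin n → ℕ} x {a b} → (∀ y → y ≢ x → f y ≤ g y) →
  f x + a ≤ g x + b → sum f + a ≤ sum g + b
sum-mono-at {f = f} {g} zero {a} {b} h hx =
  subst₂ _≤_ (xy∙z≈xz∙y (f zero) a _) (xy∙z≈xz∙y (g zero) b _)
    (+-mono-≤ hx (sum-mono (λ y → h (suc y) λ ())))
sum-mono-at {f = f} {g} (suc x) {a} {b} h hx =
  subst₂ _≤_ (sym (+-assoc (f zero) _ a)) (sym (+-assoc (g zero) _ b))
    (+-mono-≤ (h zero λ ())
      (sum-mono-at x (λ y y≢x → h (suc y) (y≢x ∘ Fin.suc-injective)) hx))

*-sum-sum : ∀ {m n} k (f : Fin m → ℕ) (g : Fin n → ℕ) →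
  k * (sum f * sum g) ≡ sum λ x → sum λ y → k * (f x * g y)
*-sum-sum k f g =
  trans (cong (k *_) (*-distribʳ-sum (sum g) f))
  (trans (*-distribˡ-sum k (λ x → f x * sum g))
  (sum-cong-≗ λ x → trans (cong (k *_) (*-distribˡ-sum (f x) g)) (*-distribˡ-sum k (λ y → f x * g y))))

count-mono : ∀ {n} {S R : Fin n → Bool} → (∀ y → S y ≡ true → R y ≡ true) → count S ≤ count R
count-mono h = sum-mono λ y → 𝟙-mono (h y)

count-insert : ∀ {n} {S R : Fin n → Bool} x → S x ≡ false → R x ≡ true →
  (∀ y → S y ≡ true → R y ≡ true) → suc (count S) ≤ count R
count-insert {S = S} {R} x x∉S x∈R h =
  subst₂ _≤_ (+-comm (count S) 1) (+-identityʳ (count R))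
    (sum-mono-at x (λ y _ → 𝟙-mono (h y)) strict)
  where
  strict : 𝟙 (S x) + 1 ≤ 𝟙 (R x) + 0
  strict rewrite x∉S | x∈R = ≤-refl

count-complement : ∀ {n} (S : Fin n → Bool) → count S + count (not ∘ S) ≡ n
count-complement {zero}  S = refl
count-complement {suc n} S with S zero
... | true  = cong suc (count-complement (S ∘ suc))
... | false = trans (+-suc _ _) (cong suc (count-complement (S ∘ suc)))

count-true : ∀ n → count {n} (λ _ → true) ≡ n
count-true zero    = refl
count-true (suc n) = cong suc (count-true n)

∃-of-count : ∀ {n} (S : Fin n → Bool) → 1 ≤ count S → ∃ λ x → S x ≡ true
∃-of-count {suc n} S h with S zero in eq
... | true  = zero , eq
... | false with x , p ← ∃-of-count (S ∘ suc) h = suc x , p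

∃≢-of-count : ∀ {n} (S : Fin n → Bool) x → 2 ≤ count S → ∃ λ y → y ≢ x × S y ≡ true
∃≢-of-count {suc n} S x h with S zero in eq
∃≢-of-count {suc n} S zero    h | false with y , p ← ∃-of-count (S ∘ suc) (≤-trans (n≤1+n 1) h) = suc y , (λ ()) , p
∃≢-of-count {suc n} S (suc x) h | false with y , q , p ← ∃≢-of-count (S ∘ suc) x h = suc y , q ∘ Fin.suc-injective , p
∃≢-of-count {suc n} S zero    (s≤s h) | true with y , p ← ∃-of-count (S ∘ suc) h = suc y , (λ ()) , p
∃≢-of-count {suc n} S (suc x) h | true = zero , (λ ()) , eq

-- With the larger number written as the smaller one plus `k`, the two sides differ by `k * k`.
4ab≤[a+b]² : ∀ a b → 4 * (a * b) ≤ (a + b) * (a + b)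
4ab≤[a+b]² a b with ≤-total a b
... | inj₁ a≤b with k , refl ← m≤n⇒∃[o]m+o≡n a≤b =
  subst (4 * (a * (a + k)) ≤_) (square a k) (m≤m+n _ (k * k))
  where
  square : ∀ a k → 4 * (a * (a + k)) + k * k ≡ (a + (a + k)) * (a + (a + k))
  square = solve-∀
... | inj₂ b≤a with k , refl ← m≤n⇒∃[o]m+o≡n b≤a =
  subst (4 * ((b + k) * b) ≤_) (square b k) (m≤m+n _ (k * k))
  where
  square : ∀ b k → 4 * ((b + k) * b) + k * k ≡ ((b + k) + b) * ((b + k) + b)
  square = solve-∀

-- Degrees and 2-paths in a tournament.

module Counting {n} (T : Tournament n) where

  e : Fin n → Fin n → ℕ
  e x y = 𝟙 (adj T x y)

  deg⁺ deg⁻ : (Fin n → Bool) → Fin n → ℕ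
  deg⁺ S x = sum λ z → 𝟙 (S z) * e x z
  deg⁻ S x = sum λ z → 𝟙 (S z) * e z x

  p₂≡count : ∀ x y → p₂ T x y ≡ count (λ z → adj T x z ∧ adj T z y)
  p₂≡count x y = length-filter-tabulate (λ z → adj T x z ∧ adj T z y) (λ z → z)

  arc-asym : ∀ {x y} → Arc T x y → adj T y x ≡ false
  arc-asym {x} {y} xy with x Fin.≟ y
  ... | yes refl = irrefl T x
  ... | no x≢y   = trans (tourn T y x (x≢y ∘ sym)) (cong not xy)

  e-pair : ∀ x y → e x y + e y x ≤ 1
  e-pair x y with adj T x y in eq
  ... | true  rewrite arc-asym eq = ≤-refl
  ... | false with adj T y x
  ...   | true  = ≤-refl
  ...   | false = z≤n

  -- Each vertex other than `x` carries at most one arc to or from `x`, and `x` itself carries none,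
  -- which leaves room for `𝟙 (S x)`.
  deg-split : ∀ S x → (deg⁻ S x + deg⁺ S x) + 𝟙 (S x) ≤ count S
  deg-split S x =
    subst₂ _≤_ (cong (_+ 𝟙 (S x)) (∑-distrib-+ (λ z → 𝟙 (S z) * e z x) _)) (+-identityʳ _)
      (sum-mono-at x (λ y _ → other y) self)
    where
    other : ∀ y → 𝟙 (S y) * e y x + 𝟙 (S y) * e x y ≤ 𝟙 (S y)
    other y = subst₂ _≤_ (*-distribˡ-+ (𝟙 (S y)) _ _) (*-identityʳ _) (*-monoʳ-≤ (𝟙 (S y)) (e-pair y x))
    self : (𝟙 (S x) * e x x + 𝟙 (S x) * e x x) + 𝟙 (S x) ≤ 𝟙 (S x) + 0
    self rewrite irrefl T x | *-zeroʳ (𝟙 (S x)) | +-identityʳ (𝟙 (S x)) = ≤-refl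

  sum-deg⁻≡sum-deg⁺ : ∀ S → sum (λ y → 𝟙 (S y) * deg⁻ S y) ≡ sum (λ y → 𝟙 (S y) * deg⁺ S y)
  sum-deg⁻≡sum-deg⁺ S =
    trans (sum-cong-≗ λ y → *-distribˡ-sum (𝟙 (S y)) (λ z → 𝟙 (S z) * e z y))
    (trans (∑-comm (λ y z → 𝟙 (S y) * (𝟙 (S z) * e z y)))
    (sum-cong-≗ λ z → trans
      (sum-cong-≗ λ y → swap-weights (𝟙 (S y)) (𝟙 (S z)) (e z y))
      (sym (*-distribˡ-sum (𝟙 (S z)) (λ y → 𝟙 (S y) * e z y)))))
    where
    swap-weights : ∀ a b c → a * (b * c) ≡ b * (a * c)
    swap-weights = solve-∀

  -- This is the bound d(d - 1)/2 on the number of arcs, without subtraction: in-degrees and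
  -- out-degrees have the same sum, and by `deg-split` the two degrees of a vertex of `S` add up to
  -- at most d - 1.
  arcs-inside : ∀ S → 2 * sum (λ y → 𝟙 (S y) * deg⁻ S y) + count S ≤ count S * count S
  arcs-inside S = begin
    2 * A⁻ + d                       ≡⟨ cong (λ t → A⁻ + t + d) (trans (+-identityʳ A⁻) (sum-deg⁻≡sum-deg⁺ S)) ⟩
    A⁻ + A⁺ + d                      ≡⟨ cong (_+ d) (∑-distrib-+ (λ y → 𝟙 (S y) * deg⁻ S y) _) ⟨
    sum B + d                        ≡⟨ ∑-distrib-+ B (𝟙 ∘ S) ⟨
    sum (λ y → B y + 𝟙 (S y))        ≤⟨ sum-mono pointwise ⟩
    sum (λ y → 𝟙 (S y) * d)          ≡⟨ *-distribʳ-sum d (𝟙 ∘ S) ⟨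
    d * d                            ∎
    where
    open ≤-Reasoning
    d = count S
    A⁻ = sum λ y → 𝟙 (S y) * deg⁻ S y
    A⁺ = sum λ y → 𝟙 (S y) * deg⁺ S y
    B : Fin n → ℕ
    B y = 𝟙 (S y) * deg⁻ S y + 𝟙 (S y) * deg⁺ S y
    pointwise : ∀ y → B y + 𝟙 (S y) ≤ 𝟙 (S y) * d
    pointwise y with S y | deg-split S y
    ... | false | _ = z≤n
    ... | true  | h = subst₂ _≤_
      (cong (_+ 1) (cong₂ _+_ (sym (+-identityʳ (deg⁻ S y))) (sym (+-identityʳ (deg⁺ S y)))))
      (sym (+-identityʳ d)) h

  module _ {π} (π≥1 : 1 ≤ π) (many : ∀ x y → x ≢ y → π ≤ p₂ T x y) where

    middles : ∀ x y → x ≢ y → π ≤ count (λ z → adj T x z ∧ adj T z y)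
    middles x y x≢y = subst (π ≤_) (p₂≡count x y) (many x y x≢y)

    ∃-middle : ∀ {x y} → x ≢ y → ∃ λ z → Arc T x z × Arc T z y
    ∃-middle {x} {y} x≢y with z , p ← ∃-of-count _ (≤-trans π≥1 (middles x y x≢y)) = z , ∧-true⁻ p

    -- Inside the out-neighbourhood of x in S every in-degree is at least π, whereas
    -- the average in-degree of a tournament on d vertices is (d − 1)/2.
    out-degree-bound : ∀ (S : Fin n → Bool) x y₀ → S y₀ ≡ true → y₀ ≢ x →
      (∀ y z → S y ≡ true → Arc T x z → Arc T z y → S z ≡ true) →
      2 * π + 1 ≤ count (λ z → S z ∧ adj T x z)
    out-degree-bound S x y₀ y₀∈S y₀≢x closed =
      *-cancelˡ-≤ d {{>-nonZero d≥1}} (begin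
        d * (2 * π + 1)                                ≡⟨ expand d π ⟩
        2 * (d * π) + d                                ≤⟨ +-monoˡ-≤ d (*-monoʳ-≤ 2 dπ≤) ⟩
        2 * sum (λ y → 𝟙 (N y) * deg⁻ N y) + d         ≤⟨ arcs-inside N ⟩
        d * d                                          ∎)
      where
      open ≤-Reasoning
      N : Fin n → Bool
      N z = S z ∧ adj T x z
      d = count N
      expand : ∀ d π → d * (2 * π + 1) ≡ 2 * (d * π) + d
      expand = solve-∀
      d≥1 : 1 ≤ d
      d≥1 = ≤-trans (≤-trans π≥1 (middles x y₀ (y₀≢x ∘ sym)))
        (count-mono λ z p → let xz , zy = ∧-true⁻ p in ∧-true⁺ (closed y₀ z y₀∈S xz zy) xz)
      local : ∀ y → N y ≡ true → π ≤ deg⁻ N y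
      local y p with y∈S , xy ← ∧-true⁻ {S y} p =
        ≤-trans (middles x y x≢y) (sum-mono λ z → subst (_ ≤_) (𝟙-∧ (N z) _)
          (𝟙-mono λ q → let xz , zy = ∧-true⁻ q in ∧-true⁺ (∧-true⁺ (closed y z y∈S xz zy) xz) zy))
        where
        x≢y : x ≢ y
        x≢y refl = contradiction (trans (sym (irrefl T x)) xy) λ ()
      dπ≤ : d * π ≤ sum (λ y → 𝟙 (N y) * deg⁻ N y)
      dπ≤ = subst (_≤ sum (λ y → 𝟙 (N y) * deg⁻ N y)) (sym (*-distribʳ-sum π (𝟙 ∘ N)))
        (sum-mono λ y → 𝟙-weigh (N y) (local y))

    -- The out-neighbourhood of `x` in `S` has at least 2π + 1 elements, and `x` is one more.
    class-bound : ∀ (S : Fin n → Bool) x y₀ → S x ≡ true → S y₀ ≡ true → y₀ ≢ x →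
      (∀ y z → S y ≡ true → Arc T x z → Arc T z y → S z ≡ true) →
      2 * π + 2 ≤ count S
    class-bound S x y₀ x∈S y₀∈S y₀≢x closed =
      ≤-trans (≤-reflexive (+-suc (2 * π) 1))
      (≤-trans (s≤s (out-degree-bound S x y₀ y₀∈S y₀≢x closed))
        (count-insert x x∉ x∈S (λ y p → let y∈S , _ = ∧-true⁻ p in y∈S)))
      where
      x∉ : S x ∧ adj T x x ≡ false
      x∉ rewrite irrefl T x | x∈S = refl

    -- Taking all vertices as `S`, every out-degree is at least 2π + 1, whereas the average is at
    -- most (n - 1)/2. It serves to exclude π = 1 where the rotation is made.
    order-bound : ∀ {u v : Fin n} → u ≢ v → 4 * π + 3 ≤ n
    order-bound {u} {v} u≢v = *-cancelˡ-≤ n {{Fin.nonZeroIndex u}} (begin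
        n * (4 * π + 3)               ≡⟨ expand n π ⟩
        2 * (n * (2 * π + 1)) + n     ≤⟨ +-monoˡ-≤ n (*-monoʳ-≤ 2 lower) ⟩
        2 * A⁻ + n                    ≡⟨ cong (2 * A⁻ +_) (sym (count-true n)) ⟩
        2 * A⁻ + count V              ≤⟨ arcs-inside V ⟩
        count V * count V             ≡⟨ cong₂ _*_ (count-true n) (count-true n) ⟩
        n * n                         ∎)
      where
      open ≤-Reasoning
      V : Fin n → Bool
      V _ = true
      A⁻ = sum λ y → 𝟙 true * deg⁻ V y
      expand : ∀ d π → d * (4 * π + 3) ≡ 2 * (d * (2 * π + 1)) + d
      expand = solve-∀
      ∃-other : ∀ x → ∃ λ y → y ≢ x
      ∃-other x with u Fin.≟ x
      ... | yes refl = v , u≢v ∘ sym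
      ... | no u≢x   = u , u≢x
      local : ∀ x → 2 * π + 1 ≤ deg⁺ V x
      local x with y , y≢x ← ∃-other x =
        ≤-trans (out-degree-bound V x y refl y≢x (λ _ _ _ _ _ → refl))
          (≤-reflexive (sum-cong-≗ λ z → sym (+-identityʳ (e x z))))
      lower : n * (2 * π + 1) ≤ A⁻
      lower = begin
        n * (2 * π + 1)                    ≡⟨ cong (_* (2 * π + 1)) (count-true n) ⟨
        count V * (2 * π + 1)              ≡⟨ *-distribʳ-sum (2 * π + 1) (𝟙 ∘ V) ⟩
        sum {n} (λ _ → 1 * (2 * π + 1))    ≤⟨ sum-mono (λ x → *-monoʳ-≤ 1 (local x)) ⟩
        sum (λ x → 𝟙 true * deg⁺ V x)      ≡⟨ sum-deg⁻≡sum-deg⁺ V ⟨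
        A⁻                                 ∎

    -- Counts the pairs of 2-paths x → z → y with ends in I by their middle z: there
    -- are deg⁻ I z * deg⁺ I z ≤ (count I)²/4 of them, and a bit fewer if z is in I.
    core-bound : ∀ (I C : Fin n → Bool) → 1 ≤ count I →
      (∀ z → I z ≡ true → C z ≡ true) →
      (∀ x y z → I x ≡ true → I y ≡ true → Arc T x z → Arc T z y → C z ≡ true) →
      4 * (count I * π) + 2 * count I ≤ count C * count I + (1 + 4 * π)
    core-bound I C i≥1 I⊆C closed = *-cancelˡ-≤ i {{>-nonZero i≥1}} (begin
        i * (4 * (i * π) + 2 * i)             ≡⟨ expandˡ i π ⟩
        4 * (i * (i * π)) + i * (2 * i)       ≤⟨ +-monoˡ-≤ (i * (2 * i)) (*-monoʳ-≤ 4 ends) ⟩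
        4 * (G + i * π) + i * (2 * i)         ≡⟨ regroup G i π ⟩
        4 * G + i * (2 * i) + 4 * (i * π)     ≤⟨ +-monoˡ-≤ (4 * (i * π)) mids ⟩
        count C * (i * i) + i + 4 * (i * π)   ≡⟨ expandʳ (count C) i π ⟩
        i * (count C * i + (1 + 4 * π))       ∎)
      where
      open ≤-Reasoning
      i = count I
      F : Fin n → Fin n → Fin n → ℕ
      F x y z = 𝟙 (C z) * ((𝟙 (I x) * e x z) * (𝟙 (I y) * e z y))
      G = sum λ x → sum λ y → sum λ z → F x y z
      expandˡ : ∀ i π → i * (4 * (i * π) + 2 * i) ≡ 4 * (i * (i * π)) + i * (2 * i)
      expandˡ = solve-∀
      expandʳ : ∀ c i π → c * (i * i) + i + 4 * (i * π) ≡ i * (c * i + (1 + 4 * π))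
      expandʳ = solve-∀
      regroup : ∀ G i π → 4 * (G + i * π) + i * (2 * i) ≡ 4 * G + i * (2 * i) + 4 * (i * π)
      regroup = solve-∀

      pair : ∀ x y → y ≢ x → 𝟙 (I x) * (𝟙 (I y) * π) ≤ sum (F x y)
      pair x y y≢x with I x in x∈I | I y in y∈I
      ... | false | _     = z≤n
      ... | true  | false = z≤n
      ... | true  | true  = begin
        1 * (1 * π)                               ≡⟨ trans (*-identityˡ (1 * π)) (*-identityˡ π) ⟩
        π                                         ≤⟨ middles x y (y≢x ∘ sym) ⟩
        count (λ z → adj T x z ∧ adj T z y)       ≤⟨ sum-mono (λ z → middle z) ⟩
        sum (λ z → 𝟙 (C z) * (1 * e x z * (1 * e z y))) ∎
        where
        middle : ∀ z → 𝟙 (adj T x z ∧ adj T z y) ≤ 𝟙 (C z) * (1 * e x z * (1 * e z y))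
        middle z with adj T x z in xz | adj T z y in zy
        ... | false | _     = z≤n
        ... | true  | false = z≤n
        ... | true  | true rewrite closed x y z x∈I y∈I xz zy = ≤-refl

      -- The pair (x, x) admits no lower bound on its 2-paths, hence the allowance `𝟙 (I x) * π`.
      from : ∀ x → 𝟙 (I x) * (i * π) ≤ sum (λ y → sum (F x y)) + 𝟙 (I x) * π
      from x = begin
        𝟙 (I x) * (i * π)                         ≡⟨ cong (𝟙 (I x) *_) (*-distribʳ-sum π (𝟙 ∘ I)) ⟩
        𝟙 (I x) * sum (λ y → 𝟙 (I y) * π)         ≡⟨ *-distribˡ-sum (𝟙 (I x)) (λ y → 𝟙 (I y) * π) ⟩
        sum (λ y → 𝟙 (I x) * (𝟙 (I y) * π))       ≡⟨ +-identityʳ _ ⟨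
        sum (λ y → 𝟙 (I x) * (𝟙 (I y) * π)) + 0   ≤⟨ sum-mono-at x (pair x) (self (I x) (sum (F x x))) ⟩
        sum (λ y → sum (F x y)) + 𝟙 (I x) * π     ∎
        where
        self : ∀ b k → 𝟙 b * (𝟙 b * π) + 0 ≤ k + 𝟙 b * π
        self false k = z≤n
        self true  k rewrite *-identityˡ (1 * π) | +-identityʳ (1 * π) = m≤n+m (1 * π) k

      ends : i * (i * π) ≤ G + i * π
      ends = begin
        i * (i * π)                               ≡⟨ *-distribʳ-sum (i * π) (𝟙 ∘ I) ⟩
        sum (λ x → 𝟙 (I x) * (i * π))             ≤⟨ sum-mono from ⟩
        sum (λ x → sum (λ y → sum (F x y)) + 𝟙 (I x) * π) ≡⟨ ∑-distrib-+ (λ x → sum (λ y → sum (F x y))) _ ⟩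
        G + sum (λ x → 𝟙 (I x) * π)               ≡⟨ cong (G +_) (*-distribʳ-sum π (𝟙 ∘ I)) ⟨
        G + i * π                                 ∎

      by-middle : G ≡ sum (λ z → 𝟙 (C z) * (deg⁻ I z * deg⁺ I z))
      by-middle = trans (sum-cong-≗ λ x → ∑-comm (F x))
        (trans (∑-comm λ x z → sum λ y → F x y z)
        (sum-cong-≗ λ z → sym (*-sum-sum (𝟙 (C z)) (λ x → 𝟙 (I x) * e x z) (λ y → 𝟙 (I y) * e z y))))

      -- With a and b the two degrees, a + b ≤ i gives 4ab ≤ i² for `z` outside `I`. For `z` in `I`
      -- even a + b ≤ i - 1, so 4ab + 2i ≤ (i - 1)² + 2i = i² + 1.
      mid : ∀ z → 4 * (𝟙 (C z) * (deg⁻ I z * deg⁺ I z)) + 𝟙 (I z) * (2 * i) ≤ 𝟙 (C z) * (i * i) + 𝟙 (I z)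
      mid z with I z in z∈I | C z in z∈C | deg-split I z
      ... | false | false | _ = z≤n
      ... | true  | false | _ = contradiction (trans (sym z∈C) (I⊆C z z∈I)) λ ()
      ... | false | true  | h = begin
        4 * (1 * (a * b)) + 0     ≡⟨ trans (+-identityʳ _) (cong (4 *_) (*-identityˡ (a * b))) ⟩
        4 * (a * b)               ≤⟨ 4ab≤[a+b]² a b ⟩
        (a + b) * (a + b)         ≤⟨ *-mono-≤ a+b≤i a+b≤i ⟩
        i * i                     ≡⟨ trans (+-identityʳ _) (*-identityˡ (i * i)) ⟨
        1 * (i * i) + 0           ∎
        where
        a = deg⁻ I z
        b = deg⁺ I z
        a+b≤i = m+n≤o⇒m≤o (a + b) h
      ... | true  | true  | h with m≤n⇒∃[o]m+o≡n h
      ...   | k , eq = begin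
        4 * (1 * (a * b)) + 1 * (2 * i)       ≡⟨ cong₂ _+_ (cong (4 *_) (*-identityˡ (a * b))) (*-identityˡ (2 * i)) ⟩
        4 * (a * b) + 2 * i                   ≤⟨ +-monoˡ-≤ (2 * i) (4ab≤[a+b]² a b) ⟩
        (a + b) * (a + b) + 2 * i             ≤⟨ m≤m+n _ _ ⟩
        (a + b) * (a + b) + 2 * i + (2 * ((a + b) * k) + k * k) ≡⟨ square ⟩
        1 * (i * i) + 1                       ∎
        where
        a = deg⁻ I z
        b = deg⁺ I z
        identity : ∀ s k → s * s + 2 * (s + 1 + k) + (2 * (s * k) + k * k) ≡ 1 * ((s + 1 + k) * (s + 1 + k)) + 1
        identity = solve-∀
        square = subst (λ i → (a + b) * (a + b) + 2 * i + (2 * ((a + b) * k) + k * k) ≡ 1 * (i * i) + 1)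
          eq (identity (a + b) k)

      mids : 4 * G + i * (2 * i) ≤ count C * (i * i) + i
      mids = begin
        4 * G + i * (2 * i)                                          ≡⟨ cong₂ _+_ (trans (cong (4 *_) by-middle) (*-distribˡ-sum 4 M)) (*-distribʳ-sum (2 * i) (𝟙 ∘ I)) ⟩
        sum (λ z → 4 * M z) + sum (λ z → 𝟙 (I z) * (2 * i))          ≡⟨ ∑-distrib-+ (λ z → 4 * M z) _ ⟨
        sum (λ z → 4 * M z + 𝟙 (I z) * (2 * i))                      ≤⟨ sum-mono mid ⟩
        sum (λ z → 𝟙 (C z) * (i * i) + 𝟙 (I z))                      ≡⟨ ∑-distrib-+ (λ z → 𝟙 (C z) * (i * i)) _ ⟩
        sum (λ z → 𝟙 (C z) * (i * i)) + i                            ≡⟨ cong (_+ i) (*-distribʳ-sum (i * i) (𝟙 ∘ C)) ⟨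
        count C * (i * i) + i                                        ∎
        where
        M : Fin n → ℕ
        M z = 𝟙 (C z) * (deg⁻ I z * deg⁺ I z)

-- Lists: keeping the ends, linkedness, first occurrences.

module _ {A : Set} where

  last-suffix : ∀ {v : A} ms M {b B} → ms ++ [ v ] ≡ M ++ b ∷ B → ∃ λ B′ → b ∷ B ≡ B′ ++ [ v ]
  last-suffix ms        []            eq = ms , sym eq
  last-suffix []        (m ∷ [])      ()
  last-suffix []        (m ∷ _ ∷ _)   ()
  last-suffix (_ ∷ ms)  (m ∷ M)       eq = last-suffix ms M (∷-injectiveʳ eq)

  -- The kept vertices `a` and `b` on either side of the block shield the two ends of the path from
  -- the replacement.
  replace-inner : ∀ {u v : A} ms L {a} X X′ {b B} → u ∷ (ms ++ [ v ]) ≡ (L ++ [ a ]) ++ X ++ b ∷ B →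
    ∃ λ ms′ → (L ++ [ a ]) ++ X′ ++ b ∷ B ≡ u ∷ (ms′ ++ [ v ])
  replace-inner ms [] X X′ eq
    with B′ , eqB ← last-suffix ms X (∷-injectiveʳ eq) =
    X′ ++ B′ , cong₂ _∷_ (sym (∷-injectiveˡ eq)) (trans (cong (X′ ++_) eqB) (sym (++-assoc X′ B′ _)))
  replace-inner {v = v} ms (l ∷ L) {a} X X′ {b} {B} eq
    with B′ , eqB ← last-suffix ms ((L ++ [ a ]) ++ X)
                      (trans (∷-injectiveʳ eq) (sym (++-assoc (L ++ [ a ]) X _))) =
    (L ++ [ a ]) ++ X′ ++ B′ , cong₂ _∷_ (sym (∷-injectiveˡ eq))
      (begin
        (L ++ [ a ]) ++ X′ ++ b ∷ B            ≡⟨ cong (λ t → (L ++ [ a ]) ++ X′ ++ t) eqB ⟩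
        (L ++ [ a ]) ++ X′ ++ B′ ++ [ v ]      ≡⟨ cong ((L ++ [ a ]) ++_) (++-assoc X′ B′ _) ⟨
        (L ++ [ a ]) ++ (X′ ++ B′) ++ [ v ]    ≡⟨ ++-assoc (L ++ [ a ]) (X′ ++ B′) _ ⟨
        ((L ++ [ a ]) ++ X′ ++ B′) ++ [ v ]    ∎)
    where open ≡-Reasoning

  module _ {R : Rel A 0ℓ} where

    Linked-++⁻ˡ : ∀ xs {ys} → Linked R (xs ++ ys) → Linked R xs
    Linked-++⁻ˡ []           l       = []
    Linked-++⁻ˡ (x ∷ [])     l       = [-]
    Linked-++⁻ˡ (x ∷ y ∷ xs) (r ∷ l) = r ∷ Linked-++⁻ˡ (y ∷ xs) l

    Linked-++⁻ʳ : ∀ xs {ys} → Linked R (xs ++ ys) → Linked R ys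
    Linked-++⁻ʳ []                     l       = l
    Linked-++⁻ʳ (x ∷ [])     {[]}      l       = []
    Linked-++⁻ʳ (x ∷ [])     {_ ∷ _}   (_ ∷ l) = l
    Linked-++⁻ʳ (x ∷ y ∷ xs)           (_ ∷ l) = Linked-++⁻ʳ (y ∷ xs) l

    Linked-∷⁺ : ∀ {x xs} → All (R x) xs → Linked R xs → Linked R (x ∷ xs)
    Linked-∷⁺ []      l = [-]
    Linked-∷⁺ (r ∷ _) l = r ∷ l

    connect-∷ʳ : ∀ xs {x y} → R x y → Connected R (last (xs ++ [ x ])) (just y)
    connect-∷ʳ []           r = just r
    connect-∷ʳ (_ ∷ [])     r = just r
    connect-∷ʳ (_ ∷ x ∷ xs) r = connect-∷ʳ (x ∷ xs) r

    connect-All : ∀ {xs y} → All (λ x → R x y) xs → Connected R (last xs) (just y)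
    connect-All []           = nothing-just
    connect-All (r ∷ [])     = just r
    connect-All (_ ∷ r ∷ rs) = connect-All (r ∷ rs)

    AllPairs-++⁻ʳ : ∀ xs {ys} → AllPairs R (xs ++ ys) → AllPairs R ys
    AllPairs-++⁻ʳ []       p       = p
    AllPairs-++⁻ʳ (x ∷ xs) (_ ∷ p) = AllPairs-++⁻ʳ xs p

    AllPairs-∷ʳ⁻ : ∀ xs {x} → AllPairs R (xs ++ [ x ]) → All (λ y → R y x) xs
    AllPairs-∷ʳ⁻ []       p       = []
    AllPairs-∷ʳ⁻ (_ ∷ xs) (r ∷ p) = All.head (All.++⁻ʳ xs r) ∷ AllPairs-∷ʳ⁻ xs p

  split-at-first : ∀ {Q : Pred A 0ℓ} → Decidable Q → ∀ {x xs} → x ∈ xs → Q x →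
    ∃₂ λ ls y → ∃ λ rs → xs ≡ ls ++ y ∷ rs × All (¬_ ∘ Q) ls × Q y
  split-at-first Q? {xs = y ∷ ys} x∈xs q with Q? y | x∈xs
  ... | yes qy | _          = [] , y , ys , refl , [] , qy
  ... | no ¬qy | here refl  = contradiction q ¬qy
  ... | no ¬qy | there x∈ys with ls , z , rs , eq , ¬ls , qz ← split-at-first Q? x∈ys q =
    y ∷ ls , z , rs , cong (y ∷_) eq , ¬qy ∷ ¬ls , qz

-- Pigeonhole: if every vertex occurred, positions would inject `Fin n` into `Fin (length xs)`.
∃∉-of-short : ∀ {n} (xs : List (Fin n)) → length xs < n → ∃ λ w → w ∉ xs
∃∉-of-short {n} xs short with Fin.any? (λ w → ¬? (_∈?_ Fin._≟_ w xs))
... | yes p = p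
... | no ¬p = contradiction (Fin.injective⇒≤ position-injective) (<⇒≱ short)
  where
  covered : ∀ w → w ∈ xs
  covered w = decidable-stable (_∈?_ Fin._≟_ w xs) λ w∉ → ¬p (w , w∉)
  position-injective : ∀ {x y} → index (covered x) ≡ index (covered y) → x ≡ y
  position-injective {x} {y} eq =
    trans (lookup-index (covered x)) (trans (cong (lookup xs) eq) (sym (lookup-index (covered y))))

-- The numerical contradiction.

-- Here `i` is the size of the initial block, `c` that of the class containing it, and `d` that of
-- the other class.
classes-too-large : ∀ {π i c d n} → 1 ≤ π → π ≤ i → 2 * π + 2 ≤ c → 2 * π + 2 ≤ d → c + d ≡ n →
  4 * (i * π) + 2 * i ≤ c * i + (1 + 4 * π) → ¬ (7 * n < 36 * π + 10)
-- For π = 1 the class sizes suffice: n ≥ 8 gives 7n ≥ 56 > 46.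
classes-too-large {1} {i} {c} {d} _ _ 4≤c 4≤d refl _ h =
  <⇒≱ h (≤-trans (m≤m+n 46 10) (*-monoʳ-≤ 7 (+-mono-≤ 4≤c 4≤d)))
classes-too-large {π@(suc (suc _))} {i} {c} {d} _ π≤i _ d-large refl core h = <⇒≱ h (begin
    36 * π + 10          ≤⟨ +-monoʳ-≤ (36 * π) (≤-trans (m≤m+n 10 2) (*-monoʳ-≤ 6 (s≤s (s≤s z≤n)))) ⟩
    36 * π + 6 * π       ≡⟨ sevenfold π ⟩
    7 * (6 * π)          ≤⟨ *-monoʳ-≤ 7 (+-cancelʳ-≤ 2 (6 * π) (c + d) sizes) ⟩
    7 * (c + d)          ∎)
  where
  open ≤-Reasoning
  sevenfold : ∀ π → 36 * π + 6 * π ≡ 7 * (6 * π)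
  sevenfold = solve-∀
  arrange₁ : ∀ c i → i + (c * i + 4 * i) ≡ (c + 3) * i + 2 * i
  arrange₁ = solve-∀
  arrange₂ : ∀ i π → (4 * π) * i + 2 * i ≡ 4 * (i * π) + 2 * i
  arrange₂ = solve-∀
  arrange₃ : ∀ c i → c * i + (1 + 4 * i) ≡ 1 + (c * i + 4 * i)
  arrange₃ = solve-∀
  arrange₄ : ∀ π → 6 * π + 2 ≡ 4 * π + (2 * π + 2)
  arrange₄ = solve-∀
  arrange₅ : ∀ c d → (c + 2) + d ≡ (c + d) + 2
  arrange₅ = solve-∀
  -- If c ≤ 4π - 3, then `core` leaves i ≤ 1, against 2 ≤ π ≤ i.
  c-large : 4 * π ≤ c + 2
  c-large = ≮⇒≥ λ c+2<4π → <⇒≱ (s≤s (s≤s z≤n)) (≤-trans π≤i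
    (+-cancelʳ-≤ (c * i + 4 * i) i 1 (begin
      i + (c * i + 4 * i)      ≡⟨ arrange₁ c i ⟩
      (c + 3) * i + 2 * i      ≤⟨ +-monoˡ-≤ (2 * i) (*-monoˡ-≤ i (≤-trans (≤-reflexive (+-suc c 2)) c+2<4π)) ⟩
      (4 * π) * i + 2 * i      ≡⟨ arrange₂ i π ⟩
      4 * (i * π) + 2 * i      ≤⟨ core ⟩
      c * i + (1 + 4 * π)      ≤⟨ +-monoʳ-≤ (c * i) (s≤s (*-monoʳ-≤ 4 π≤i)) ⟩
      c * i + (1 + 4 * i)      ≡⟨ arrange₃ c i ⟩
      1 + (c * i + 4 * i)      ∎)))
  sizes : 6 * π + 2 ≤ (c + d) + 2
  sizes = begin
    6 * π + 2                  ≡⟨ arrange₄ π ⟩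
    4 * π + (2 * π + 2)        ≤⟨ +-mono-≤ c-large d-large ⟩
    (c + 2) + d                ≡⟨ arrange₅ c d ⟩
    (c + d) + 2                ∎

-- Extending a path by insertion or rotation.

module Paths {n} (T : Tournament n) {u v : Fin n} {xs : List (Fin n)} (path : IsPath T u v xs)
  where

  inner : List (Fin n)
  inner = proj₁ (proj₁ path)

  shape : xs ≡ u ∷ (inner ++ [ v ])
  shape = proj₂ (proj₁ path)

  linked : Linked (Arc T) xs
  linked = proj₁ (proj₂ path)

  -- Common frame of both operations: a block strictly inside the path is exchanged, so the ends
  -- survive, and distinctness is carried over by the permutation.
  extend : ∀ {w} L {a} X X′ {b B} → w ∉ xs → xs ≡ (L ++ [ a ]) ++ X ++ b ∷ B →
    X′ ++ b ∷ B ↭ w ∷ X ++ b ∷ B → Linked (Arc T) ((L ++ [ a ]) ++ X′ ++ b ∷ B) → Extendable T u v xs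
  extend {w} L {a} X X′ {b} {B} w∉xs eq perm link =
    ys , (replace-inner inner L X X′ (trans (sym shape) eq) , link , unique-ys) , w , w∉xs , ys↭
    where
    ys = (L ++ [ a ]) ++ X′ ++ b ∷ B
    ys↭ : ys ↭ w ∷ xs
    ys↭ = ↭-trans (++⁺ˡ (L ++ [ a ]) perm)
      (↭-trans (shift w (L ++ [ a ]) _) (↭-reflexive (cong (w ∷_) (sym eq))))
    unique-ys : Unique ys
    unique-ys = Permutationₛ.Unique-resp-↭ (setoid (Fin n)) (↭⇒↭ₛ (↭-sym ys↭))
      (All.¬Any⇒All¬ xs w∉xs ∷ proj₂ (proj₂ path))

  insert : ∀ {w} L {a b B} → w ∉ xs → xs ≡ (L ++ [ a ]) ++ b ∷ B → Arc T a w → Arc T w b → Extendable T u v xs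
  insert {w} L {a} {b} {B} w∉xs eq aw wb =
    extend L [] [ w ] w∉xs eq (↭-reflexive refl)
      (Linked.++⁺ (Linked-++⁻ˡ (L ++ [ a ]) l) (connect-∷ʳ L aw) (wb ∷ Linked-++⁻ʳ (L ++ [ a ]) l))
    where
    l = subst (Linked (Arc T)) eq linked

  -- The path L a | M y | z x₀ R | b B becomes L a | z x₀ R | w | M y | b B.
  rotate : ∀ {w} L {a} M {y} z x₀ R {b B} → w ∉ xs →
    xs ≡ (L ++ [ a ]) ++ ((M ++ [ y ]) ++ (z ∷ x₀ ∷ R)) ++ b ∷ B →
    Arc T a z → Arc T y b → All (λ x → Arc T x w) (x₀ ∷ R) → All (Arc T w) (M ++ [ y ]) →
    Extendable T u v xs
  rotate {w} L {a} M {y} z x₀ R {b} {B} w∉xs eq az yb R→w w→M =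
    extend L ((M ++ [ y ]) ++ Z) (Z ++ (w ∷ M ++ [ y ])) w∉xs eq perm
      (subst (Linked (Arc T)) (cong ((L ++ [ a ]) ++_) (sym (++-assoc Z (w ∷ M ++ [ y ]) (b ∷ B))))
        (Linked.++⁺ (Linked-++⁻ˡ (L ++ [ a ]) l) (connect-∷ʳ L az)
        (Linked.++⁺ (Linked-++⁻ʳ (M ++ [ y ]) (Linked-++⁻ˡ ((M ++ [ y ]) ++ Z) l₂)) (connect-All R→w)
        (Linked.++⁺ (Linked-∷⁺ w→M (Linked-++⁻ˡ (M ++ [ y ]) (Linked-++⁻ˡ ((M ++ [ y ]) ++ Z) l₂))) (connect-∷ʳ (w ∷ M) yb)
          (Linked-++⁻ʳ ((M ++ [ y ]) ++ Z) l₂)))))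
    where
    Z = z ∷ x₀ ∷ R
    l = subst (Linked (Arc T)) eq linked
    l₂ = Linked-++⁻ʳ (L ++ [ a ]) l
    perm : (Z ++ (w ∷ M ++ [ y ])) ++ b ∷ B ↭ w ∷ ((M ++ [ y ]) ++ Z) ++ b ∷ B
    perm = ↭-trans (↭-reflexive (++-assoc Z (w ∷ M ++ [ y ]) (b ∷ B)))
      (↭-trans (shift w Z _)
      (↭-prep w (↭-trans (shifts Z (M ++ [ y ])) (↭-reflexive (sym (++-assoc (M ++ [ y ]) Z _))))))

  -- The vertices that dominate `w` form a final segment. The pairwise form gives this without
  -- naming the place where the direction changes.
  Backward : Fin n → List (Fin n) → Set
  Backward w = AllPairs (λ x y → Arc T x w → Arc T y w)

  insert-or-backward : ∀ w → w ∉ xs → Extendable T u v xs ⊎ Backward w xs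
  insert-or-backward w w∉xs with scan [] xs refl
    where
    R : Fin n → Fin n → Set
    R x y = Arc T x w → Arc T y w
    scan : ∀ L ys → xs ≡ L ++ ys → Extendable T u v xs ⊎ Linked R ys
    scan L []           eq = inj₂ []
    scan L (x ∷ [])     eq = inj₂ [-]
    scan L (x ∷ y ∷ ys) eq with scan (L ++ [ x ]) (y ∷ ys) (trans eq (sym (++-assoc L [ x ] _)))
    ... | inj₁ ext = inj₁ ext
    ... | inj₂ l with adj T x w in xw | adj T y w in yw
    ...   | false | _    = inj₂ ((λ xw′ → contradiction (trans (sym xw) xw′) λ ()) ∷ l)
    ...   | true  | true = inj₂ ((λ _ → yw) ∷ l)
    -- The direction changes the wrong way between the neighbours `x` and `y`, so `w` fits between
    -- them.
    ...   | true  | false = inj₁ (insert L w∉xs (trans eq (sym (++-assoc L [ x ] _))) xw wy)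
      where
      w≢y : w ≢ y
      w≢y refl = w∉xs (subst (w ∈_) (sym eq) (∈-++⁺ʳ L (there (here refl))))
      wy : Arc T w y
      wy = trans (tourn T w y w≢y) (cong not yw)
  ... | inj₁ ext = inj₁ ext
  -- Implication is transitive, so the property of consecutive vertices spreads to all pairs.
  ... | inj₂ l   = inj₂ (Linked.Linked⇒AllPairs (λ f g → g ∘ f) l)

-- Membership as a Boolean, and ends of lists.

member : ∀ {n} → List (Fin n) → Fin n → Bool
member xs z = does (_∈?_ Fin._≟_ z xs)

module _ {n} (xs : List (Fin n)) where

  member⁺ : ∀ {z} → z ∈ xs → member xs z ≡ true
  member⁺ {z} = dec-true (_∈?_ Fin._≟_ z xs)

  member⁻ : ∀ {z} → member xs z ≡ true → z ∈ xs
  member⁻ {z} eq with yes z∈xs ← _∈?_ Fin._≟_ z xs = z∈xs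

  ∉⁺ : ∀ {z} → z ∉ xs → not (member xs z) ≡ true
  ∉⁺ {z} z∉xs = cong not (dec-false (_∈?_ Fin._≟_ z xs) z∉xs)

  ∉⁻ : ∀ {z} → not (member xs z) ≡ true → z ∉ xs
  ∉⁻ {z} eq with no z∉xs ← _∈?_ Fin._≟_ z xs = z∉xs

∃-snoc : ∀ {A : Set} {a : A} {xs} → a ∈ xs → ∃₂ λ ys y → xs ≡ ys ++ [ y ]
∃-snoc {xs = xs} a∈xs with initLast xs
∃-snoc ()   | []
∃-snoc a∈xs | ys ∷ʳ′ y = ys , y , refl

∈-init : ∀ {A : Set} {a y : A} {ys} → a ≢ y → a ∈ ys ++ [ y ] → a ∈ ys
∈-init {ys = ys} a≢y a∈ with ∈-++⁻ ys a∈
... | inj₁ a∈ys        = a∈ys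
... | inj₂ (here a≡y)  = contradiction a≡y a≢y

-- For π = 1 the hypotheses read n ≥ 7 and 7n < 46.
at-least-2 : ∀ {π n} → 1 ≤ π → 4 * π + 3 ≤ n → 7 * n < 36 * π + 10 → 2 ≤ π
at-least-2 {1}           _ 7≤n h = contradiction (≤-trans (m≤m+n 46 3) (*-monoʳ-≤ 7 7≤n)) (<⇒≱ h)
at-least-2 {suc (suc _)} _ _   _ = s≤s (s≤s z≤n)

-- Paths into which no outside vertex can be inserted.

module NonInsertable {n} (T : Tournament n) {π} (π≥1 : 1 ≤ π) (many : ∀ x y → x ≢ y → π ≤ p₂ T x y)
  {u v : Fin n} {xs : List (Fin n)} (path : IsPath T u v xs)
  (backward : ∀ w → w ∉ xs → Paths.Backward T path w xs) where

  open Counting T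
  open Paths T path

  inP inW : Fin n → Bool
  inP = member xs
  inW = not ∘ member xs

  in-or-out : ∀ z → z ∈ xs ⊎ z ∉ xs
  in-or-out z with _∈?_ Fin._≟_ z xs
  ... | yes p = inj₁ p
  ... | no ¬p = inj₂ ¬p

  no-2-cycle : ∀ {x y} → Arc T x y → ¬ Arc T y x
  no-2-cycle xy yx = contradiction (trans (sym yx) (arc-asym xy)) λ ()

  no-loop : ∀ {x} → ¬ Arc T x x
  no-loop xx = no-2-cycle xx xx

  reverse-arc : ∀ {x y} → x ≢ y → ¬ Arc T x y → Arc T y x
  reverse-arc {x} {y} x≢y ¬xy with adj T x y | tourn T y x (x≢y ∘ sym)
  ... | true  | _  = contradiction refl ¬xy
  ... | false | eq = eq

  apart : ∀ {x w} → x ∈ xs → w ∉ xs → x ≢ w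
  apart x∈xs w∉xs refl = w∉xs x∈xs

  u∈xs : u ∈ xs
  u∈xs = subst (u ∈_) (sym shape) (here refl)

  v∈xs : v ∈ xs
  v∈xs = subst (v ∈_) (sym shape) (∈-++⁺ʳ (u ∷ inner) (here refl))

  u≢v : u ≢ v
  u≢v with fresh ∷ _ ← subst Unique shape (proj₂ (proj₂ path)) =
    All.lookup fresh (∈-++⁺ʳ inner (here refl))

  -- In the merged order such a `w` stands before `u`, hence before the whole path.
  from-start : ∀ {w} → w ∉ xs → Arc T u w → ∀ {x} → x ∈ xs → Arc T x w
  from-start {w} w∉xs uw x∈xs
    with onward ∷ _ ← subst (Backward w) shape (backward w w∉xs) | subst (_ ∈_) shape x∈xs
  ... | here refl = uw
  ... | there x∈  = All.lookup onward x∈ uw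

  -- Such a `w` stands after `v`: any path vertex dominating `w` would force `v` to dominate it too.
  to-end : ∀ {w} → w ∉ xs → Arc T w v → ∀ {x} → x ∈ xs → Arc T w x
  to-end {w} w∉xs wv {x} x∈xs = reverse-arc (apart x∈xs w∉xs) λ xw → no-2-cycle wv (vw xw)
    where
    vw : Arc T x w → Arc T v w
    vw xw with ∈-++⁻ (u ∷ inner) (subst (x ∈_) shape x∈xs)
    ... | inj₁ x∈ = All.lookup (AllPairs-∷ʳ⁻ (u ∷ inner) (subst (Backward w) shape (backward w w∉xs))) x∈ xw
    ... | inj₂ (here refl) = xw

  -- An outside vertex dominated by `u` is dominated by the whole path, so no 2-path from `u`
  -- returns to the path through it.
  path-large : 2 * π + 2 ≤ count inP
  path-large = class-bound π≥1 many inP u v (member⁺ xs u∈xs) (member⁺ xs v∈xs) (u≢v ∘ sym) closed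
    where
    closed : ∀ y z → inP y ≡ true → Arc T u z → Arc T z y → inP z ≡ true
    closed y z y∈P uz zy with in-or-out z
    ... | inj₁ z∈xs = member⁺ xs z∈xs
    ... | inj₂ z∉xs = ⊥-elim (no-2-cycle zy (from-start z∉xs uz (member⁻ xs y∈P)))

  -- The case in which the merged order begins outside the path. The initial block consists of the
  -- outside vertices that `u` dominates, and `u` is the first vertex after it.
  outside-after-start : ∀ {w₀} → w₀ ∉ xs → Arc T u w₀ → ¬ (7 * n < 36 * π + 10)
  outside-after-start {w₀} w₀∉xs uw₀
    -- The middle `w₁` is outside, since all path vertices dominate `w₀`; as it dominates `v`, it
    -- stands after the whole path.
    with w₁ , w₀w₁ , w₁v ← ∃-middle π≥1 many {w₀} {v} (apart v∈xs w₀∉xs ∘ sym) =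
    classes-too-large π≥1 core-large outside-large path-large sizes
      (core-bound π≥1 many I inW (≤-trans π≥1 core-large) (λ z → proj₁ ∘ ∧-true⁻)
        λ x y z x∈I y∈I xz zy → let x∉xs , ux = I⁻ x∈I in
          out z λ z∈xs → no-2-cycle xz (from-start x∉xs ux z∈xs))
    where
    I : Fin n → Bool
    I z = inW z ∧ adj T u z
    I⁻ : ∀ {z} → I z ≡ true → z ∉ xs × Arc T u z
    I⁻ {z} z∈I = ∉⁻ xs (proj₁ (∧-true⁻ {inW z} z∈I)) , proj₂ (∧-true⁻ {inW z} z∈I)
    out : ∀ z → z ∉ xs → inW z ≡ true
    out z = ∉⁺ xs
    w₁∉xs : w₁ ∉ xs
    w₁∉xs w₁∈xs = no-2-cycle w₀w₁ (from-start w₀∉xs uw₀ w₁∈xs)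
    w₁u : Arc T w₁ u
    w₁u = to-end w₁∉xs w₁v u∈xs
    w₁≢w₀ : w₁ ≢ w₀
    w₁≢w₀ refl = no-2-cycle uw₀ w₁u
    core-large : π ≤ count I
    core-large = ≤-trans (middles π≥1 many u w₁ (apart u∈xs w₁∉xs)) (count-mono λ z p →
      let uz , zw₁ = ∧-true⁻ p in
      ∧-true⁺ (out z λ z∈xs → no-2-cycle zw₁ (to-end w₁∉xs w₁v z∈xs)) uz)
    outside-large : 2 * π + 2 ≤ count inW
    outside-large = class-bound π≥1 many inW w₀ w₁ (∉⁺ xs w₀∉xs) (∉⁺ xs w₁∉xs) w₁≢w₀
      λ y z _ w₀z _ → out z λ z∈xs → no-2-cycle w₀z (from-start w₀∉xs uw₀ z∈xs)
    sizes : count inW + count inP ≡ n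
    sizes = trans (+-comm (count inW) _) (count-complement inP)

  module StartDominated (start : ∀ {w} → w ∉ xs → Arc T w u) where

    -- Otherwise `w` dominates the whole path, and a 2-path from `u` to `w` has no possible middle:
    -- path vertices do not reach `w`, and `u` reaches no outside vertex.
    end-dominates : ∀ {w} → w ∉ xs → Arc T v w
    end-dominates {w} w∉xs = reverse-arc (apart v∈xs w∉xs ∘ sym) λ wv → absurd wv
      where
      absurd : ¬ Arc T w v
      absurd wv with z , uz , zw ← ∃-middle π≥1 many {u} {w} (apart u∈xs w∉xs) | in-or-out z
      ... | inj₁ z∈xs = no-2-cycle zw (to-end w∉xs wv z∈xs)
      ... | inj₂ z∉xs = no-2-cycle uz (start z∉xs)

    dominates : ∀ {ls x₀ rs} → xs ≡ ls ++ x₀ ∷ rs → All (λ x → ¬ ∃ λ w → w ∉ xs × Arc T x w) ls →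
      ∀ {x w} → x ∈ ls → w ∉ xs → Arc T w x
    dominates split ¬enters {x} {w} x∈ls w∉xs =
      reverse-arc (apart (subst (x ∈_) (sym split) (∈-++⁺ˡ x∈ls)) w∉xs)
        λ xw → All.lookup ¬enters x∈ls (w , w∉xs , xw)

    module FirstEntry {w₀ x₀ ls rs} (w₀∉xs : w₀ ∉ xs) (x₀w₀ : Arc T x₀ w₀) (split : xs ≡ ls ++ x₀ ∷ rs)
      (dominated : ∀ {x w} → x ∈ ls → w ∉ xs → Arc T w x) where

      later : All (λ x → Arc T x w₀) (x₀ ∷ rs)
      later with onward ∷ _ ← AllPairs-++⁻ʳ ls (subst (Backward w₀) split (backward w₀ w₀∉xs)) =
        x₀w₀ ∷ All.map (λ f → f x₀w₀) onward

      ls⊆xs : ∀ {x} → x ∈ ls → x ∈ xs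
      ls⊆xs x∈ls = subst (_ ∈_) (sym split) (∈-++⁺ˡ x∈ls)

      early : ∀ {z} → z ∈ xs → Arc T w₀ z → z ∈ ls
      early z∈xs w₀z with ∈-++⁻ ls (subst (_ ∈_) split z∈xs)
      ... | inj₁ z∈ls = z∈ls
      ... | inj₂ z∈   = ⊥-elim (no-2-cycle w₀z (All.lookup later z∈))

      late : ∀ {z} → z ∈ xs → Arc T z w₀ → z ∈ x₀ ∷ rs
      late z∈xs zw₀ with ∈-++⁻ ls (subst (_ ∈_) split z∈xs)
      ... | inj₁ z∈ls = ⊥-elim (no-2-cycle zw₀ (dominated z∈ls w₀∉xs))
      ... | inj₂ z∈   = z∈

      -- As a set this is `ls`, the initial block of the merged order; `w₀` is a first outside
      -- vertex after it.
      I : Fin n → Bool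
      I z = inP z ∧ adj T w₀ z

      I⇒ls : ∀ {z} → I z ≡ true → z ∈ ls
      I⇒ls {z} z∈I = let z∈P , w₀z = ∧-true⁻ {inP z} z∈I in early (member⁻ xs z∈P) w₀z

      path-mid : ∀ {z} → ¬ (z ∉ xs) → inP z ≡ true
      path-mid {z} ¬z∉ = member⁺ xs (decidable-stable (_∈?_ Fin._≟_ z xs) ¬z∉)

      core-large : π ≤ count I
      -- All outside vertices are dominated by `v`, so the middles of 2-paths from `w₀` to `v` are
      -- on the path.
      core-large = ≤-trans (middles π≥1 many w₀ v (apart v∈xs w₀∉xs ∘ sym)) (count-mono {S = λ z → adj T w₀ z ∧ adj T z v} {R = I} λ z p →
        let w₀z , zv = ∧-true⁻ p in
        ∧-true⁺ (path-mid λ z∉xs → no-2-cycle zv (end-dominates z∉xs)) w₀z)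

      two-outside : ∀ {w₁} → w₁ ∉ xs → w₁ ≢ w₀ → ¬ (7 * n < 36 * π + 10)
      two-outside {w₁} w₁∉xs w₁≢w₀ =
        classes-too-large π≥1 core-large path-large outside-large (count-complement inP)
          (core-bound π≥1 many I inP (≤-trans π≥1 core-large) (λ z → proj₁ ∘ ∧-true⁻)
            λ x y z x∈I y∈I xz zy → path-mid λ z∉xs → no-2-cycle xz (dominated (I⇒ls x∈I) z∉xs))
        where
        outside-large : 2 * π + 2 ≤ count inW
        outside-large = class-bound π≥1 many inW w₀ w₁ (∉⁺ xs w₀∉xs) (∉⁺ xs w₁∉xs) w₁≢w₀
          λ y z y∈W w₀z zy → ∉⁺ xs λ z∈xs → no-2-cycle zy (dominated (early z∈xs w₀z) (∉⁻ xs y∈W))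

      module OneOutside (only : ∀ {w} → w ∉ xs → w ≡ w₀) (π≥2 : 2 ≤ π) where

        ∃-middle≢ : ∀ {x y} → x ≢ y → ∀ a → ∃ λ z → z ≢ a × Arc T x z × Arc T z y
        ∃-middle≢ {x} {y} x≢y a with z , z≢a , p ← ∃≢-of-count _ a (≤-trans π≥2 (middles π≥1 many x y x≢y)) =
          z , z≢a , ∧-true⁻ p

        middle-into : ∀ {z} → Arc T w₀ z → z ∈ ls
        middle-into {z} w₀z = early (decidable-stable (_∈?_ Fin._≟_ z xs)
          λ z∉xs → no-loop (subst (Arc T w₀) (only z∉xs) w₀z)) w₀z

        middle-out : ∀ {z} → Arc T z w₀ → z ∈ x₀ ∷ rs
        middle-out {z} zw₀ = late (decidable-stable (_∈?_ Fin._≟_ z xs)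
          λ z∉xs → no-loop (subst (λ t → Arc T t w₀) (only z∉xs) zw₀)) zw₀

        -- The vertex `w₀` dominates exactly `ls` on the path and is dominated by the rest. With
        -- `y`, `z` the last two vertices of `ls`, the arcs a → z and y → b allow the rotation.
        rotated : Extendable T u v xs
        rotated
          with _ , s∈I ← ∃-of-count I (≤-trans π≥1 core-large)
          with L₀ , z , ls≡ ← ∃-snoc (I⇒ls s∈I)
          with w₀≢z ← apart (ls⊆xs (subst (z ∈_) (sym ls≡) (∈-insert L₀))) w₀∉xs ∘ sym
          with shorten ← (λ {a} (w₀a : Arc T w₀ a) (az : Arc T a z) →
            ∈-init (λ { refl → no-loop az }) (subst (a ∈_) ls≡ (middle-into w₀a)))
          with _ , w₀a′ , a′z ← ∃-middle π≥1 many w₀≢z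
          with L₁ , y , L₀≡ ← ∃-snoc (shorten w₀a′ a′z)
          -- Avoiding `y` puts `a` before `y`, so the block moved behind `w₀` ends in `y`.
          with a , a≢y , w₀a , az ← ∃-middle≢ w₀≢z y
          with A , M , L₁≡ ← ∈-∃++ (∈-init a≢y (subst (a ∈_) L₀≡ (shorten w₀a az)))
          -- Avoiding `x₀` puts `b` after it, so the block moved in front of `w₀` ends in a vertex
          -- that dominates `w₀`.
          with b , b≢x₀ , yb , bw₀ ← ∃-middle≢ (apart (ls⊆xs (subst (y ∈_) (sym ls≡)
                 (∈-++⁺ˡ (subst (y ∈_) (sym L₀≡) (∈-insert L₁))))) w₀∉xs) x₀
          with R , B , rs≡ ← ∈-∃++ (tail b≢x₀ (middle-out bw₀)) =
          rotate A M z x₀ R w₀∉xs (trans split′ (regroup A)) az yb R→w₀ w₀→M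
          where
          blocks : ls ≡ ((A ++ a ∷ M) ++ [ y ]) ++ [ z ]
          blocks = trans ls≡ (cong (_++ [ z ]) (trans L₀≡ (cong (_++ [ y ]) L₁≡)))
          split′ : xs ≡ (((A ++ a ∷ M) ++ [ y ]) ++ [ z ]) ++ x₀ ∷ R ++ b ∷ B
          split′ = trans split (cong₂ (λ ls rs → ls ++ x₀ ∷ rs) blocks rs≡)
          regroup : ∀ A → (((A ++ a ∷ M) ++ [ y ]) ++ [ z ]) ++ x₀ ∷ R ++ b ∷ B ≡
            (A ++ [ a ]) ++ ((M ++ [ y ]) ++ z ∷ x₀ ∷ R) ++ b ∷ B
          regroup []      = cong (a ∷_) (trans (++-assoc (M ++ [ y ]) [ z ] _)
            (sym (++-assoc (M ++ [ y ]) (z ∷ x₀ ∷ R) _)))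
          regroup (x ∷ A) = cong (x ∷_) (regroup A)
          w₀→M : All (Arc T w₀) (M ++ [ y ])
          w₀→M = All.tail (All.++⁻ʳ A (subst (All (Arc T w₀)) (++-assoc A (a ∷ M) [ y ])
            (All.++⁻ˡ ((A ++ a ∷ M) ++ [ y ]) (subst (All (Arc T w₀)) blocks
              (All.tabulate λ x∈ls → dominated x∈ls w₀∉xs)))))
          R→w₀ : All (λ x → Arc T x w₀) (x₀ ∷ R)
          R→w₀ = All.++⁻ˡ (x₀ ∷ R) (subst (λ rs → All (λ x → Arc T x w₀) (x₀ ∷ rs)) rs≡ later)

    extendable : 7 * n < 36 * π + 10 → length xs < n → Extendable T u v xs
    extendable bound short
      with w , w∉xs ← ∃∉-of-short xs short
      -- The initial block ends just before the first path vertex that dominates an outside vertex;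
      -- `v` is such a vertex, so the search succeeds.
      with ls , x₀ , rs , split , ¬enters , w₀ , w₀∉xs , x₀w₀ ←
        split-at-first (λ x → Fin.any? λ w → ¬? (_∈?_ Fin._≟_ w xs) ×-dec adj T x w Bool.≟ true)
          v∈xs (w , w∉xs , end-dominates w∉xs)
      with Fin.any? (λ w → ¬? (_∈?_ Fin._≟_ w xs) ×-dec ¬? (w Fin.≟ w₀))
    ... | yes (w₁ , w₁∉xs , w₁≢w₀) = ⊥-elim (two-outside w₁∉xs w₁≢w₀ bound)
      where open FirstEntry w₀∉xs x₀w₀ split (dominates split ¬enters)
    ... | no ¬other = rotated
      where
      open FirstEntry w₀∉xs x₀w₀ split (dominates split ¬enters)
      open OneOutside (λ {w} w∉xs → decidable-stable (w Fin.≟ w₀) λ w≢w₀ → ¬other (w , w∉xs , w≢w₀))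
        (at-least-2 π≥1 (order-bound π≥1 many u≢v) bound)

-- The case distinction and the choice of π.

path-extendable : ∀ {n} (T : Tournament n) {π} → 1 ≤ π → (∀ x y → x ≢ y → π ≤ p₂ T x y) →
  7 * n < 36 * π + 10 → PathExtendable T
path-extendable {n} T π≥1 many bound u v xs path short
  -- Sequencing in the sum applicative yields an extension by some vertex, or the backward property
  -- for all outside vertices at once.
  with Fin.sequence (Sumₗ.applicative (Extendable T u v xs) 0ℓ) choice
  where
  choice : ∀ w → Extendable T u v xs ⊎ (w ∉ xs → Paths.Backward T path w xs)
  choice w with _∈?_ Fin._≟_ w xs
  ... | yes w∈xs = inj₂ (contradiction w∈xs)
  ... | no w∉xs with Paths.insert-or-backward T path w w∉xs
  ...   | inj₁ ext  = inj₁ ext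
  ...   | inj₂ back = inj₂ λ _ → back
... | inj₁ ext      = ext
... | inj₂ backward with Fin.any? (λ w → ¬? (_∈?_ Fin._≟_ w xs) ×-dec adj T u w Bool.≟ true)
...   | yes (w₀ , w₀∉xs , uw₀) = ⊥-elim (outside-after-start w₀∉xs uw₀ bound)
  where open NonInsertable T π≥1 many path backward
...   | no ¬after = StartDominated.extendable
  (λ {w} w∉xs → reverse-arc (apart u∈xs w∉xs) λ uw → ¬after (w , w∉xs , uw)) bound short
  where open NonInsertable T π≥1 many path backward

theorem7 : (n : ℕ) (T : Tournament n) →
    (∀ (u v : Fin n) → u ≢ v → 7 * n < 36 * p₂ T u v + 10) →
    PathExtendable T
-- With at most one vertex no path is nonhamiltonian, since the list of a path is nonempty.
theorem7 0 T many = λ ()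
theorem7 1 T many u v []      ((_ , ()) , _) short
theorem7 1 T many u v (_ ∷ _) path           (s≤s ())
theorem7 n@(suc (suc m)) T many = path-extendable T (positive π π-large) π≤p₂ π-large
  where
  open ≤-Reasoning
  -- The least π with 7 * n < 36 * π + 10.
  π = (7 * n + 26) / 36
  π-large : 7 * n < 36 * π + 10
  π-large = +-cancelʳ-≤ 26 (suc (7 * n)) (36 * π + 10) (begin
    suc (7 * n + 26)                        ≡⟨ cong suc (m≡m%n+[m/n]*n (7 * n + 26) 36) ⟩
    suc ((7 * n + 26) % 36 + π * 36)        ≤⟨ +-monoˡ-≤ (π * 36) (m%n<n (7 * n + 26) 36) ⟩
    36 + π * 36                             ≡⟨ arrange π ⟩
    36 * π + 10 + 26                        ∎)
    where
    arrange : ∀ π → 36 + π * 36 ≡ 36 * π + 10 + 26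
    arrange = solve-∀
  -- π = 0 would mean 7n < 10, but n ≥ 2.
  positive : ∀ π → 7 * n < 36 * π + 10 → 1 ≤ π
  positive zero    h = contradiction (≤-trans (m≤m+n 10 4) (*-monoʳ-≤ 7 (s≤s (s≤s (z≤n {m}))))) (<⇒≱ h)
  positive (suc π) h = s≤s z≤n
  π≤p₂ : ∀ x y → x ≢ y → π ≤ p₂ T x y
  -- From 36π ≤ 7n + 26 < 36(p₂ + 1) it follows that π < p₂ + 1.
  π≤p₂ x y x≢y = s≤s⁻¹ (*-cancelʳ-< 36 π (suc (p₂ T x y)) (begin-strict
    π * 36                                  ≤⟨ m/n*n≤m (7 * n + 26) 36 ⟩
    7 * n + 26                              <⟨ +-monoˡ-< 26 (many x y x≢y) ⟩
    36 * p₂ T x y + 10 + 26                 ≡⟨ arrange (p₂ T x y) ⟩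
    suc (p₂ T x y) * 36                     ∎))
    where
    arrange : ∀ p → 36 * p + 10 + 26 ≡ suc p * 36
    arrange = solve-∀
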